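{- Let $n \ge 5$ be an integer, and for $1 \le i \le n$ let $e_i \in \{0,1\}^n$ be the binary string with a $1$ in the $i$-th coordinate and $0$ in all other coordinates. Then $S = \{e_2, e_3, \ldots, e_n\}$ is a minimal resolving set for the hypercube $Q^n$.
   Context: The $n$-dimensional hypercube $Q^n$ is the graph with vertex set $\{0,1\}^n$ in which two vertices are adjacent when they differ in exactly one coordinate; the graph distance $d(x,y)$ is the number of coordinates in which $x$ and $y$ differ. For a graph $G=(V,E)$ and an ordered subset $S = \{s_1,\ldots,s_k\} \subseteq V$, put $d(v,S) = (d(v,s_1),\ldots,d(v,s_k))$ for $v \in V$. The set $S$ is a resolving set for $G$ if $d(u,S) \ne d(v,S)$ for all vertices $u \ne v$ of $G$ (whether $S$ is resolving does not depend on the ordering). A resolving set is minimal if no proper subset of it is a resolving set. -}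

module Defs where

open import Data.Bool.Base using (Bool; true; false; not)
open import Data.Bool.Properties using (_≟_; not-¬)
open import Data.Empty using (⊥-elim)
open import Data.Fin.Base using (Fin; zero; suc)
open import Data.Fin.Properties using (0≢1+n; suc-injective)
open import Data.List.Base using (List; map)
open import Data.List.Relation.Binary.Subset.Propositional using (_⊆_)
open import Data.Nat.Base using (ℕ; zero; suc; _≤_; s≤s)
open import Data.Nat.Properties using (≤-refl; ≤-reflexive; ≤-trans; n≤1+n)
open import Data.Product using (∃!; _×_; _,_)
open import Data.Vec.Base using (Vec; []; _∷_; lookup; replicate; zip; count; _[_]≔_)
open import Relation.Binary.PropositionalEquality
  using (_≡_; _≢_; refl; sym; cong; cong₂)
open import Relation.Nullary using (¬_)
open import Relation.Nullary.Decidable using (¬?; decidable-stable)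

record Graph : Set₁ where
  field
    V        : Set
    _~_      : V → V → Set
    ~-sym    : ∀ {u v} → u ~ v → v ~ u
    ~-irrefl : ∀ {v} → ¬ (v ~ v)

data Walk (G : Graph) : Graph.V G → Graph.V G → ℕ → Set where
  nil  : ∀ {v} → Walk G v v 0
  cons : ∀ {u v w k} → Graph._~_ G u v → Walk G v w k → Walk G u w (suc k)

IsDistance : (G : Graph) → (Graph.V G → Graph.V G → ℕ) → Set
IsDistance G d =
  ∀ u v → Walk G u v (d u v) × (∀ {k} → Walk G u v k → d u v ≤ k)

-- A graph together with its (uniquely determined) distance function;
-- since d is ℕ-valued, the graph is necessarily connected.
record ConnectedGraph : Set₁ where
  field
    graph      : Graph
    d          : Graph.V graph → Graph.V graph → ℕ
    isDistance : IsDistance graph d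
  open Graph graph public

-- Finite vertex sets are lists, identified with their sets of members:
-- neither order nor repetition affects whether a list is resolving, and
-- inclusion is inclusion of members.
module _ (G : ConnectedGraph) where
  open ConnectedGraph G

  distances : V → List V → List ℕ
  distances v S = map (d v) S

  IsResolving : List V → Set
  IsResolving S = ∀ {u v} → u ≢ v → distances u S ≢ distances v S

  IsMinimalResolving : List V → Set
  IsMinimalResolving S =
    IsResolving S × (∀ T → T ⊆ S → ¬ (S ⊆ T) → ¬ IsResolving T)

Adjacent : ∀ {n} → Vec Bool n → Vec Bool n → Set
Adjacent x y = ∃! _≡_ λ i → lookup x i ≢ lookup y i

hamming : ∀ {n} → Vec Bool n → Vec Bool n → ℕ
hamming x y = count (λ (a , b) → ¬? (a ≟ b)) (zip x y)

Q-graph : ℕ → Graph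
Q-graph n = record
  { V        = Vec Bool n
  ; _~_      = Adjacent
  ; ~-sym    = λ (i , p , uniq) → i , (λ q → p (sym q)) , λ q → uniq (λ r → q (sym r))
  ; ~-irrefl = λ (_ , p , _) → p refl
  }

private
  lookup-ext : ∀ {n} (x y : Vec Bool n) → (∀ i → lookup x i ≡ lookup y i) → x ≡ y
  lookup-ext []      []      _ = refl
  lookup-ext (_ ∷ x) (_ ∷ y) h = cong₂ _∷_ (h zero) (lookup-ext x y (λ i → h (suc i)))

  hamming-refl : ∀ {n} (x : Vec Bool n) → hamming x x ≡ 0
  hamming-refl []          = refl
  hamming-refl (true ∷ x)  = hamming-refl x
  hamming-refl (false ∷ x) = hamming-refl x

  hamming-∷-≤ : ∀ {n} a b (x y : Vec Bool n) → hamming (a ∷ x) (b ∷ y) ≤ suc (hamming x y)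
  hamming-∷-≤ true  true  x y = n≤1+n _
  hamming-∷-≤ true  false x y = ≤-refl
  hamming-∷-≤ false true  x y = ≤-refl
  hamming-∷-≤ false false x y = n≤1+n _

  hamming-≤-∷ : ∀ {n} a b (x y : Vec Bool n) → hamming x y ≤ hamming (a ∷ x) (b ∷ y)
  hamming-≤-∷ true  true  x y = ≤-refl
  hamming-≤-∷ true  false x y = n≤1+n _
  hamming-≤-∷ false true  x y = n≤1+n _
  hamming-≤-∷ false false x y = ≤-refl

  hamming-∷-mono : ∀ {n} a b {x y z : Vec Bool n} → hamming x z ≤ suc (hamming y z) →
                   hamming (a ∷ x) (b ∷ z) ≤ suc (hamming (a ∷ y) (b ∷ z))
  hamming-∷-mono true  true  h = h
  hamming-∷-mono true  false h = s≤s h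
  hamming-∷-mono false true  h = s≤s h
  hamming-∷-mono false false h = h

  hamming-step : ∀ {n} (x y z : Vec Bool n) → Adjacent x y → hamming x z ≤ suc (hamming y z)
  hamming-step (a ∷ x) (b ∷ y) (c ∷ z) (zero , _ , uniq)
    with refl ← lookup-ext x y (λ i → decidable-stable (lookup x i ≟ lookup y i)
                                  (λ p → 0≢1+n (uniq {suc i} p)))
    = ≤-trans (hamming-∷-≤ a c x z) (s≤s (hamming-≤-∷ b c x z))
  hamming-step (a ∷ x) (b ∷ y) (c ∷ z) (suc i , p , uniq)
    with refl ← decidable-stable (a ≟ b) (λ q → 0≢1+n (sym (uniq {zero} q)))
    = hamming-∷-mono a c {x} {y} {z}
        (hamming-step x y z (i , p , λ q → suc-injective (uniq {suc _} q)))

  hamming-≤ : ∀ {n k} {x y : Vec Bool n} → Walk (Q-graph n) x y k → hamming x y ≤ k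
  hamming-≤ {x = x} nil = ≤-reflexive (hamming-refl x)
  hamming-≤ (cons {u} {v} {w} a p) = ≤-trans (hamming-step u v w a) (s≤s (hamming-≤ p))

  walk-∷ : ∀ {n k} a {x y : Vec Bool n} → Walk (Q-graph n) x y k →
           Walk (Q-graph (suc n)) (a ∷ x) (a ∷ y) k
  walk-∷ a nil = nil
  walk-∷ a (cons (i , p , uniq) w) =
    cons (suc i , p , λ { {zero} q → ⊥-elim (q refl) ; {suc _} q → cong suc (uniq q) })
         (walk-∷ a w)

  flip-head : ∀ {n} a (x : Vec Bool n) → Adjacent (a ∷ x) (not a ∷ x)
  flip-head a x =
    zero , not-¬ refl , λ { {zero} _ → refl ; {suc _} q → ⊥-elim (q refl) }

  walk : ∀ {n} (x y : Vec Bool n) → Walk (Q-graph n) x y (hamming x y)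
  walk []          []          = nil
  walk (true ∷ x)  (true ∷ y)  = walk-∷ true (walk x y)
  walk (true ∷ x)  (false ∷ y) = cons (flip-head true x) (walk-∷ false (walk x y))
  walk (false ∷ x) (true ∷ y)  = cons (flip-head false x) (walk-∷ true (walk x y))
  walk (false ∷ x) (false ∷ y) = walk-∷ false (walk x y)

Q : ℕ → ConnectedGraph
Q n = record
  { graph      = Q-graph n
  ; d          = hamming
  ; isDistance = λ x y → walk x y , hamming-≤
  }

-- Coordinates are indexed from zero: the string eᵢ (1 ≤ i ≤ n) is e at
-- the element of Fin n with value i − 1.
e : ∀ {n} → Fin n → Vec Bool n
e i = replicate _ false [ i ]≔ true

-- Writing |x| for the number of ones of x, d(x, eᵢ) = |x| + 1 − 2xᵢ.  So if x and
-- y have the same distances to e₂, …, eₙ, then |x| − |y| = 2(xᵢ − yᵢ) for all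
-- i ≥ 2.  If this common value is 0, then x = y; if it is 2 (or, symmetrically, −2), x is all ones
-- and y all zeros past the first coordinate, so |x| − |y| ≥ n − 2 > 2.
-- Minimality: distinct eᵢ are at distance 2, so if eⱼ is not in T ⊆ S then every
-- element of T is at distance 2 from both e₁ and eⱼ.
module Submission where

open import Defs
open import Data.Bool.Base using (Bool; true; false)
import Data.Bool.Properties as Bool
open import Data.Fin.Base using (Fin; zero; suc)
open import Data.List.Base using (List; map; drop; allFin)
open import Data.List.Membership.Propositional using (_∈_)
open import Data.List.Membership.Propositional.Properties
  using (∈-map⁻; ∈-map⁺; ∈-tabulate⁺; ∈-tabulate⁻)
open import Data.List.Properties using (map-cong-local; ∷-injectiveˡ; ∷-injectiveʳ)
open import Data.List.Relation.Unary.All using (tabulate)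
open import Data.List.Relation.Unary.Any using (here; there)
open import Data.Nat.Base using (ℕ; suc; _+_; _≤_; s≤s)
open import Data.Nat.Properties using (suc-injective; m≢1+n+m)
open import Data.Product using (∃; _×_; _,_; proj₁; proj₂)
open import Data.Vec.Base using (Vec; []; _∷_; lookup; replicate)
open import Data.Vec.Properties using (lookup-replicate; lookup∘update′; ≡-dec)
open import Data.Vec.Relation.Binary.Pointwise.Extensional
  using (ext; Pointwise-≡⇒≡)
open import Relation.Binary.PropositionalEquality
  using (_≡_; _≢_; refl; sym; ≢-sym; trans; cong)
open import Relation.Nullary using (yes; no; contradiction)

private
  variable
    n : ℕ

∈-map-≡ : {A B : Set} {f g : A → B} {xs : List A} {x : A} →
          map f xs ≡ map g xs → x ∈ xs → f x ≡ g x
∈-map-≡ eq (here refl) = ∷-injectiveˡ eq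
∈-map-≡ eq (there x∈)  = ∈-map-≡ (∷-injectiveʳ eq) x∈

lookup-injective : {A : Set} {x y : Vec A n} → (∀ i → lookup x i ≡ lookup y i) → x ≡ y
lookup-injective h = Pointwise-≡⇒≡ (ext h)

lookup-constant : {A : Set} {b : A} {x : Vec A n} → (∀ i → lookup x i ≡ b) → x ≡ replicate n b
lookup-constant h = lookup-injective λ i → trans (h i) (sym (lookup-replicate i _))

-- Writing |x| as a distance to the zero string lets it unfold one coordinate at a time alongside
-- `hamming x (e i)`, so the base cases below hold by `refl`.
weight : Vec Bool n → ℕ
weight x = hamming x (replicate _ false)

weight-ones : ∀ n → weight (replicate n true) ≡ n
weight-ones 0       = refl
weight-ones (suc n) = cong suc (weight-ones n)

weight-zeros : ∀ n → weight (replicate n false) ≡ 0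
weight-zeros 0       = refl
weight-zeros (suc n) = weight-zeros n

weight-e : (i : Fin n) → weight (e i) ≡ 1
weight-e {suc n} zero    = cong suc (weight-zeros n)
weight-e         (suc i) = weight-e i

-- The strings `e i` and zero differ only at `i`, so trading one for the other changes the distance
-- from `x` by one. The cases xᵢ = 1 and xᵢ = 0 are kept apart to avoid subtraction.
hamming-e-true : (x : Vec Bool n) (i : Fin n) → lookup x i ≡ true →
                 suc (hamming x (e i)) ≡ weight x
hamming-e-true (true  ∷ x) zero    _ = refl
hamming-e-true (true  ∷ x) (suc i) p = cong suc (hamming-e-true x i p)
hamming-e-true (false ∷ x) (suc i) p = hamming-e-true x i p

hamming-e-false : (x : Vec Bool n) (i : Fin n) → lookup x i ≡ false →
                  hamming x (e i) ≡ suc (weight x)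
hamming-e-false (false ∷ x) zero    _ = refl
hamming-e-false (true  ∷ x) (suc i) p = cong suc (hamming-e-false x i p)
hamming-e-false (false ∷ x) (suc i) p = hamming-e-false x i p

hamming-e-e : {i j : Fin n} → i ≢ j → hamming (e i) (e j) ≡ 2
hamming-e-e {i = i} {j} i≢j =
  trans (hamming-e-false (e i) j eᵢⱼ≡0) (cong suc (weight-e i))
  where
  eᵢⱼ≡0 : lookup (e i) j ≡ false
  eᵢⱼ≡0 = trans (lookup∘update′ (≢-sym i≢j) (replicate _ false) true) (lookup-replicate j false)

-- The three values 0, 2, -2 of |x| - |y| = 2(xᵢ - yᵢ). The last field of each constructor does not
-- mention `i`, so the case found at one coordinate is the case at all of them.
data Compare (x y : Vec Bool n) (i : Fin n) : Set where
  same : lookup x i ≡ lookup y i → weight x ≡ weight y → Compare x y i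
  down : lookup x i ≡ true → lookup y i ≡ false → weight x ≡ 2 + weight y → Compare x y i
  up   : lookup x i ≡ false → lookup y i ≡ true → weight y ≡ 2 + weight x → Compare x y i

compare : (x y : Vec Bool n) (i : Fin n) → hamming x (e i) ≡ hamming y (e i) → Compare x y i
compare x y i h with lookup x i in p | lookup y i in q
... | true  | true  = same (trans p (sym q))
  (trans (sym (hamming-e-true x i p)) (trans (cong suc h) (hamming-e-true y i q)))
... | false | false = same (trans p (sym q)) (suc-injective
  (trans (sym (hamming-e-false x i p)) (trans h (hamming-e-false y i q))))
... | true  | false = down p q
  (trans (sym (hamming-e-true x i p)) (cong suc (trans h (hamming-e-false y i q))))
... | false | true  = up p q
  (trans (sym (hamming-e-true y i q)) (cong suc (trans (sym h) (hamming-e-false x i p))))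

-- Equal weights exclude the other two cases, where a number would exceed itself by 2.
lookup-≡ : (x y : Vec Bool n) (i : Fin n) → weight x ≡ weight y →
           hamming x (e i) ≡ hamming y (e i) → lookup x i ≡ lookup y i
lookup-≡ x y i w h with compare x y i h
... | same p _   = p
... | down _ _ v = contradiction (trans (sym w) v) (m≢1+n+m _)
... | up _ _ v   = contradiction (trans w v) (m≢1+n+m _)

lookup-down : (x y : Vec Bool n) (i : Fin n) → weight x ≡ 2 + weight y →
              hamming x (e i) ≡ hamming y (e i) → lookup x i ≡ true × lookup y i ≡ false
lookup-down x y i w h with compare x y i h
... | same _ v   = contradiction (trans (sym v) w) (m≢1+n+m _)
... | down p q _ = p , q
... | up _ _ v   = contradiction (trans w (cong (2 +_) v)) (m≢1+n+m _)

-- Recovers the first coordinate, which is the one that e₂, ..., eₙ do not compare directly.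
head-≡ : ∀ {a b} {x : Vec Bool n} → weight (a ∷ x) ≡ weight (b ∷ x) → a ≡ b
head-≡ {a = true}  {true}  _ = refl
head-≡ {a = false} {false} _ = refl
head-≡ {a = true}  {false} w = contradiction (sym w) (m≢1+n+m _)
head-≡ {a = false} {true}  w = contradiction w (m≢1+n+m _)

¬weight-gap-2 : ∀ a b (x y : Vec Bool n) → 4 ≤ n →
                (∀ i → lookup x i ≡ true × lookup y i ≡ false) →
                weight (a ∷ x) ≢ 2 + weight (b ∷ y)
¬weight-gap-2 {n} a b x y 4≤n h
  with refl ← lookup-constant {x = x} (λ i → proj₁ (h i))
     | refl ← lookup-constant {x = y} (λ i → proj₂ (h i))
  = gap a b 4≤n
  where
  gap : ∀ a b → 4 ≤ n → weight (a ∷ replicate n true) ≢ 2 + weight (b ∷ replicate n false)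
  gap true  true  rewrite weight-ones n | weight-zeros n = λ { (s≤s (s≤s (s≤s _))) () }
  gap true  false rewrite weight-ones n | weight-zeros n = λ { (s≤s (s≤s _)) () }
  -- The tight case: the equation becomes n ≡ 3, and refuting it takes all of `4 ≤ n`.
  gap false true  rewrite weight-ones n | weight-zeros n = λ { (s≤s (s≤s (s≤s (s≤s _)))) () }
  gap false false rewrite weight-ones n | weight-zeros n = λ { (s≤s (s≤s (s≤s _))) () }

resolves : 4 ≤ n → (x y : Vec Bool (suc n)) →
           (∀ i → hamming x (e (suc i)) ≡ hamming y (e (suc i))) → x ≡ y
-- Any coordinate past the first would decide the case; matching on `s≤s` ensures that a second one
-- exists.
resolves 4≤n@(s≤s _) u@(a ∷ x) v@(b ∷ y) h with compare u v (suc zero) (h zero)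
... | same _ w
  with refl ← lookup-injective {x = x} {y} (λ i → lookup-≡ u v (suc i) w (h i))
  = cong (_∷ x) (head-≡ {x = x} w)
... | down _ _ w = contradiction w
  (¬weight-gap-2 a b x y 4≤n λ i → lookup-down u v (suc i) w (h i))
... | up _ _ w = contradiction w
  (¬weight-gap-2 b a y x 4≤n λ i → lookup-down v u (suc i) w (sym (h i)))

theorem3 : (n : ℕ) → 5 ≤ n →
    -- dropping the first coordinate leaves e₂, …, eₙ
    IsMinimalResolving (Q n) (map e (drop 1 (allFin n)))
theorem3 (suc n) (s≤s 4≤n) = resolving , minimal
  where
  S : List (Vec Bool (suc n))
  S = map e (drop 1 (allFin (suc n)))

  e∈S : ∀ i → e (suc i) ∈ S
  e∈S i = ∈-map⁺ e (∈-tabulate⁺ {f = suc} i)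

  ∈S⇒e : ∀ {s} → s ∈ S → ∃ λ i → s ≡ e (suc i)
  ∈S⇒e s∈S with _ , j∈ , refl ← ∈-map⁻ e s∈S with i , refl ← ∈-tabulate⁻ {f = suc} j∈ = i , refl

  resolving : IsResolving (Q (suc n)) S
  resolving x≢y eq = x≢y (resolves 4≤n _ _ λ i → ∈-map-≡ eq (e∈S i))

  minimal : ∀ T → _ → _ → _
  minimal T T⊆S S⊈T res = S⊈T S⊆T
    where
    open import Data.List.Membership.DecPropositional (≡-dec Bool._≟_) using (_∈?_)

    -- Membership is decidable, so it is enough to refute that `s` is missing from `T`.
    S⊆T : ∀ {s} → s ∈ S → s ∈ T
    S⊆T {s} s∈S with s ∈? T
    ... | yes s∈T = s∈T
    ... | no  s∉T with j , refl ← ∈S⇒e s∈S =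
      contradiction (map-cong-local (tabulate equidistant)) (res {e zero} {e (suc j)} λ ())
      where
      equidistant : ∀ {t} → t ∈ T → hamming (e zero) t ≡ hamming (e (suc j)) t
      equidistant t∈T with i , refl ← ∈S⇒e (T⊆S t∈T) =
        trans (hamming-e-e {i = zero} {suc i} λ ())
          -- If `i` were `j`, then `t` would be the missing element itself.
          (sym (hamming-e-e {i = suc j} {suc i} λ { refl → s∉T t∈T }))
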